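{- Let $i\ge 3$ and $k\ge 3$ be integers. Then: (a) $g_1(L_i,L_{i+2},L_{i+k})=(2L_i-1)L_{i+2}-L_i$ whenever $k\ge i+4$; (b) $g_1(L_i,L_{i+2},L_{2i+3})=(F_{i+3}-1)L_{i+2}-L_i$; (c) $g_1(L_i,L_{i+2},L_{2i+2})=(3F_{i-1}-1)L_{i+2}+L_{2i+2}-L_i$; (d) if $r=\lfloor (L_i-1)/F_k\rfloor\ge 1$ (equivalently $k\le i+1$), then $$g_1(L_i,L_{i+2},L_{i+k})=\begin{cases}(L_i-rF_k-1)L_{i+2}+(r+1)L_{i+k}-L_i & \text{if } (L_i-rF_k)L_{i+2}\ge F_{k-2}L_i,\\ (F_k-1)L_{i+2}+rL_{i+k}-L_i & \text{if } (L_i-rF_k)L_{i+2}< F_{k-2}L_i.\end{cases}$$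
   Context: Fibonacci numbers: $F_0=0$, $F_1=1$, $F_n=F_{n-1}+F_{n-2}$. Lucas numbers: $L_0=2$, $L_1=1$, $L_n=L_{n-1}+L_{n-2}$. For positive integers $a_1,\dots,a_l$ with $\gcd(a_1,\dots,a_l)=1$ and an integer $n$, let $d(n;a_1,\dots,a_l)$ be the number of tuples $(x_1,\dots,x_l)$ of nonnegative integers with $a_1x_1+\dots+a_lx_l=n$. For a nonnegative integer $p$, the $p$-Frobenius number $g_p(a_1,\dots,a_l)$ is the largest integer $n$ with $d(n;a_1,\dots,a_l)\le p$. -}

module Defs where

open import Data.Integer as ℤ using (ℤ; +_; ∣_∣)
import Data.Integer.Properties as ℤ
open import Data.List using (List; []; _∷_; length; filter; upTo; cartesianProductWith)
open import Data.List.Membership.Propositional using (_∈_)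
open import Data.List.Membership.Propositional.Properties
  using (∈-filter⁺; ∈-filter⁻; ∈-cartesianProductWith⁺; ∈-upTo⁺)
import Data.List.Relation.Unary.All as ListAll
import Data.List.Relation.Unary.AllPairs as AllPairs
open import Data.List.Relation.Unary.Any using (here)
open import Data.List.Relation.Unary.Unique.Propositional using (Unique)
import Data.List.Relation.Unary.Unique.Propositional.Properties as Unique
open import Data.Nat
open import Data.Nat.GCD using (gcd)
open import Data.Nat.Properties
open import Data.Product using (_×_; _,_; proj₂)
open import Data.Vec as Vec using (Vec; []; _∷_)
import Data.Vec.Properties as Vec
open import Data.Vec.Relation.Unary.All using (All; []; _∷_)
open import Function.Bundles using (_⇔_; mk⇔)
open import Relation.Binary.PropositionalEquality using (_≡_; refl; cong)

F : ℕ → ℕ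
F 0             = 0
F 1             = 1
F (suc (suc n)) = F (suc n) + F n

L : ℕ → ℕ
L 0             = 2
L 1             = 1
L (suc (suc n)) = L (suc n) + L n

private
  F-suc-pos : ∀ n → 0 < F (suc n)
  F-suc-pos zero    = s≤s z≤n
  F-suc-pos (suc n) = ≤-trans (F-suc-pos n) (m≤m+n (F (suc n)) (F n))

F-nonZero : ∀ {k} → 3 ≤ k → NonZero (F k)
F-nonZero {suc k} _ = >-nonZero (F-suc-pos k)

infix 8 _·_

_·_ : ∀ {l} → Vec ℕ l → Vec ℕ l → ℕ
a · x = Vec.sum (Vec.zipWith _*_ a x)

tuples : ℕ → (l : ℕ) → List (Vec ℕ l)
tuples b zero    = [] ∷ []
tuples b (suc l) = cartesianProductWith _∷_ (upTo (suc b)) (tuples b l)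

-- For positive a every solution has all xⱼ ≤ ∣ n ∣, so searching that box
-- loses nothing (∈-solutions).  For negative n the list is empty.
solutions : ∀ {l} → ℤ → Vec ℕ l → List (Vec ℕ l)
solutions {l} n a = filter (λ x → + (a · x) ℤ.≟ n) (tuples ∣ n ∣ l)

d : ∀ {l} → ℤ → Vec ℕ l → ℕ
d n a = length (solutions n a)

private
  ∈-tuples : ∀ {l b} (a x : Vec ℕ l) → All NonZero a → a · x ≤ b → x ∈ tuples b l
  ∈-tuples []       []       []         _   = here refl
  ∈-tuples (a ∷ as) (x ∷ xs) (nz ∷ nzs) a·x≤b =
    ∈-cartesianProductWith⁺ _∷_
      (∈-upTo⁺ (s≤s (≤-trans (m≤n*m x a {{nz}}) (≤-trans (m≤m+n (a * x) (as · xs)) a·x≤b))))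
      (∈-tuples as xs nzs (≤-trans (m≤n+m (as · xs) (a * x)) a·x≤b))

  tuples-unique : ∀ b l → Unique (tuples b l)
  tuples-unique b zero    = ListAll.[] AllPairs.∷ AllPairs.[]
  tuples-unique b (suc l) =
    Unique.cartesianProductWith⁺ _∷_ Vec.∷-injective
      (Unique.upTo⁺ (suc b)) (tuples-unique b l)

∈-solutions : ∀ {l} n (a x : Vec ℕ l) → All NonZero a → x ∈ solutions n a ⇔ + (a · x) ≡ n
∈-solutions {l} n a x nz = mk⇔
  (λ x∈ → proj₂ (∈-filter⁻ (λ y → + (a · y) ℤ.≟ n) {xs = tuples ∣ n ∣ l} x∈))
  (λ eq → ∈-filter⁺ (λ y → + (a · y) ℤ.≟ n)
            (∈-tuples a x nz (≤-reflexive (cong ∣_∣ eq))) eq)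

solutions-unique : ∀ {l} n (a : Vec ℕ l) → Unique (solutions n a)
solutions-unique {l} n a = Unique.filter⁺ (λ x → + (a · x) ℤ.≟ n) (tuples-unique ∣ n ∣ l)

-- g_p(a) = g as a relation.  The first two fields are the conditions under
-- which g_p(a) is defined; the last two determine g uniquely.
record IsFrobenius (p : ℕ) {l : ℕ} (a : Vec ℕ l) (g : ℤ) : Set where
  field
    positive : All NonZero a
    coprime  : Vec.foldr′ gcd 0 a ≡ 1
    few      : d g a ≤ p
    largest  : ∀ n → d n a ≤ p → n ℤ.≤ g

-- Write a, b, c for the generators, f = F k and e = F (k − 2).  Since
-- c + e a = f b, the value b y + c z lies in the residue class of b t modulo a,
-- where t = y + f z, and it decreases with z for fixed t.  Hence g₁ = G − a
-- as soon as every t < a is congruent to the class of two pairs (y, z) of value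
-- at most G, while some t < min a f has all its pairs except (t, 0) of value at
-- least G.  The second pair of a small class t is found by going once around:
-- divide t + a by f with remainder.  Its largest value occurs either at the
-- largest small class or just before the quotient increases, and these are the
-- two competing expressions of the theorem.
module Submission where

open import Defs
import Data.Integer as ℤ
import Data.Integer.Properties as ℤ
import Data.Integer.Tactic.RingSolver as ℤ-Solver
open import Data.List using (List; []; _∷_; length)
open import Data.List.Membership.Propositional using (_∈_)
import Data.List.Relation.Unary.All as All
open import Data.List.Relation.Unary.AllPairs using ([]; _∷_)
open import Data.List.Relation.Unary.Any using (here; there)
open import Data.List.Relation.Unary.Unique.Propositional using (Unique)
open import Data.Nat as ℕ using (ℕ; zero; suc; NonZero; >-nonZero⁻¹; z≤n; s≤s; _/_)
open import Data.Nat.Coprimality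
  using (Coprime; coprime-Bézout; coprime-divisor)
open import Data.Nat.Divisibility using (_∣_; divides; ∣-trans; ∣1⇒≡1; ∣m+n∣m⇒∣n)
open import Data.Nat.DivMod
  using (_%_; m≡m%n+[m/n]*n; m%n<n; m<n⇒m/n≡0; m≥n⇒m/n>0)
open import Data.Nat.GCD using (gcd; gcd[m,n]∣m; gcd[m,n]∣n; module Bézout)
open import Data.Nat.Properties
open import Data.Nat.Tactic.RingSolver using (solve-∀)
open import Data.Product using (∃; ∃₂; _×_; _,_; proj₁; proj₂)
open import Data.Sum using (_⊎_; inj₁; inj₂)
open import Data.Vec as Vec using (Vec; []; _∷_)
open import Data.Vec.Properties using (∷-injective)
import Data.Vec.Relation.Unary.All as VecAll
open import Function.Bundles using (_⇔_; mk⇔; Equivalence)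
open import Relation.Binary.PropositionalEquality
open import Relation.Nullary using (¬_; yes; no; contradiction)

-- Lists with at most one element.

module _ {A : Set} where

  length≤1⇒≡ : {xs : List A} {x y : A} → length xs ℕ.≤ 1 → x ∈ xs → y ∈ xs → x ≡ y
  length≤1⇒≡ {_ ∷ []}    _        (here refl) (here refl) = refl
  length≤1⇒≡ {_ ∷ _ ∷ _} (s≤s ()) _           _

  ≡⇒length≤1 : {xs : List A} → Unique xs → (∀ {x y} → x ∈ xs → y ∈ xs → x ≡ y) → length xs ℕ.≤ 1
  ≡⇒length≤1 {[]}        _                      _  = z≤n
  ≡⇒length≤1 {_ ∷ []}    _                      _  = s≤s z≤n
  ≡⇒length≤1 {_ ∷ _ ∷ _} ((x≢y All.∷ _) ∷ _) eq =
    contradiction (eq (here refl) (there (here refl))) x≢y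

-- Linear congruences modulo `a`, without subtraction.

-- Congruence of u and v modulo a appears as an equation u + a * p ≡ v + a * q.
module Congruence (a b : ℕ) {{_ : NonZero a}} (a⊥b : Coprime a b) where
  open import Data.Nat using (_+_; _*_; _∸_; _≤_; _<_)

  -- Writing `u = t + w` reduces the equation to `a p = a q + b w`; hence `a` divides `b w` and, by
  -- coprimality, `w`.
  cancel-≤ : ∀ {t u p q} → t ≤ u → b * t + a * p ≡ b * u + a * q → ∃ λ m → u ≡ t + m * a
  cancel-≤ {t} {p = p} {q} t≤u eq with m≤n⇒∃[o]m+o≡n t≤u
  ... | w , refl with coprime-divisor {o = w} a⊥b
                        (∣m+n∣m⇒∣n (divides p (trans (sym ap≡) (*-comm a p))) (divides q (*-comm a q)))
    where
    distribute : ∀ a b t w q → b * (t + w) + a * q ≡ b * t + (a * q + b * w)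
    distribute = solve-∀
    ap≡ : a * p ≡ a * q + b * w
    ap≡ = +-cancelˡ-≡ (b * t) _ _ (trans eq (distribute a b t w q))
  ... | divides m refl = m , refl

  cancel : ∀ {t u p q} → b * t + a * p ≡ b * u + a * q →
           (∃ λ m → u ≡ t + m * a) ⊎ (∃ λ m → t ≡ u + m * a)
  cancel {t} {u} eq with ≤-total t u
  ... | inj₁ t≤u = inj₁ (cancel-≤ t≤u eq)
  ... | inj₂ u≤t = inj₂ (cancel-≤ u≤t (sym eq))

  solvable : ∀ n → ∃ λ j → ∃₂ λ p q → n + a * p ≡ b * j + a * q
  solvable n with coprime-Bézout a⊥b
  ... | Bézout.-+ x y eq = y * n , x * n , 0 , (begin
    n + a * (x * n)        ≡⟨ factor a x n ⟩
    (1 + x * a) * n        ≡⟨ cong (_* n) eq ⟩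
    y * b * n              ≡⟨ swap b y n a ⟩
    b * (y * n) + a * 0    ∎)
    where
    open ≡-Reasoning
    factor : ∀ a x n → n + a * (x * n) ≡ (1 + x * a) * n
    factor = solve-∀
    swap : ∀ b y n a → y * b * n ≡ b * (y * n) + a * 0
    swap = solve-∀
  -- Here b * y is inverse to -1, so n is first multiplied by -1 = a - 1.
  ... | Bézout.+- x y eq = y * n * ℕ.pred a , x * n * ℕ.pred a , n , (begin
    n + a * (x * n * ℕ.pred a)                ≡⟨ regroup n a x (ℕ.pred a) ⟩
    n + x * a * (n * ℕ.pred a)                ≡⟨ cong (λ w → n + w * (n * ℕ.pred a)) eq ⟨
    n + (1 + y * b) * (n * ℕ.pred a)          ≡⟨ collect n y b (ℕ.pred a) ⟩
    b * (y * n * ℕ.pred a) + suc (ℕ.pred a) * n ≡⟨ cong (λ w → b * (y * n * ℕ.pred a) + w * n) (suc-pred a) ⟩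
    b * (y * n * ℕ.pred a) + a * n            ∎)
    where
    open ≡-Reasoning
    regroup : ∀ n a x a′ → n + a * (x * n * a′) ≡ n + x * a * (n * a′)
    regroup = solve-∀
    collect : ∀ n y b a′ → n + (1 + y * b) * (n * a′) ≡ b * (y * n * a′) + (1 + a′) * n
    collect = solve-∀

  solvable-< : ∀ n → ∃ λ j → j < a × ∃₂ λ p q → n + a * p ≡ b * j + a * q
  solvable-< n with solvable n
  ... | j , p , q , eq = j % a , m%n<n j a , p , b * (j / a) + q , (begin
    n + a * p                                ≡⟨ eq ⟩
    b * j + a * q                            ≡⟨ cong (λ w → b * w + a * q) (m≡m%n+[m/n]*n j a) ⟩
    b * (j % a + j / a * a) + a * q          ≡⟨ regroup b (j % a) (j / a) a q ⟩
    b * (j % a) + a * (b * (j / a) + q)      ∎)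
    where
    open ≡-Reasoning
    regroup : ∀ b r d a q → b * (r + d * a) + a * q ≡ b * r + a * (b * d + q)
    regroup = solve-∀

-- Three generators related by `c + e a = f b`.

module Frobenius₁ (a b c e f : ℕ) {{a≢0 : NonZero a}} {{b≢0 : NonZero b}} {{c≢0 : NonZero c}} {{f≢0 : NonZero f}}
  (a⊥b : Coprime a b) (c+ea≡fb : c ℕ.+ e ℕ.* a ≡ f ℕ.* b) where

  open import Data.Nat using (_+_; _*_; _≤_; _<_)
  open Congruence a b a⊥b

  abc : Vec ℕ 3
  abc = a ∷ b ∷ c ∷ []

  -- Since `c = f b - e a`, each `c` counts as `f` copies of `b` modulo `a`. The correction
  -- `a (e z)` is kept exactly, because comparing it for two pairs decides which value is smaller.
  value-class : ∀ y z → b * y + c * z + a * (e * z) ≡ b * (y + f * z)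
  value-class y z = begin
    b * y + c * z + a * (e * z)   ≡⟨ collect a b c e y z ⟩
    b * y + (c + e * a) * z       ≡⟨ cong (λ w → b * y + w * z) c+ea≡fb ⟩
    b * y + f * b * z             ≡⟨ factor b f y z ⟩
    b * (y + f * z)               ∎
    where
    open ≡-Reasoning
    collect : ∀ a b c e y z → b * y + c * z + a * (e * z) ≡ b * y + (c + e * a) * z
    collect = solve-∀
    factor : ∀ b f y z → b * y + f * b * z ≡ b * (y + f * z)
    factor = solve-∀

  -- The pair (y, z) stands for the value b * y + c * z; its class is y + f * z.
  record Below (G j y z : ℕ) : Set where
    constructor below
    field
      wraps   : ℕ
      class   : y + f * z ≡ j + wraps * a
      bounded : b * y + c * z ≤ G

  -- Only the pairs have to differ, not their values: the solutions built from them keep `y` and `z`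
  -- as coordinates, so they differ as well.
  TwoBelow : ℕ → ℕ → Set
  TwoBelow G j = ∃₂ λ y z → ∃₂ λ y′ z′ → ¬ (y ≡ y′ × z ≡ z′) × Below G j y z × Below G j y′ z′

  -- The value is congruent to `N` modulo `a` and at most `G < N`, so the difference is a positive
  -- multiple of `a`. The multiplier is a successor because `N` will be `n + a`: removing one `a`
  -- leaves a nonnegative coefficient.
  below⇒solution : ∀ {G j y z N p q} → Below G j y z → G < N → N + a * p ≡ b * j + a * q →
                   ∃ λ x → N ≡ a * suc x + (b * y + c * z)
  below⇒solution {G} {j} {y} {z} {N} {p} {q} (below m class v≤G) G<N N≡bj = answer
    where
    v P Q : ℕ
    v = b * y + c * z
    P = e * z + q
    Q = p + b * m

    v≡N : v + a * P ≡ N + a * Q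
    v≡N = begin
      v + a * (e * z + q)            ≡⟨ expand v a (e * z) q ⟩
      v + a * (e * z) + a * q        ≡⟨ cong (_+ a * q) (value-class y z) ⟩
      b * (y + f * z) + a * q        ≡⟨ cong (λ w → b * w + a * q) class ⟩
      b * (j + m * a) + a * q        ≡⟨ move b j m a q ⟩
      (b * j + a * q) + a * (b * m)  ≡⟨ cong (_+ a * (b * m)) N≡bj ⟨
      (N + a * p) + a * (b * m)      ≡⟨ expand N a p (b * m) ⟨
      N + a * (p + b * m)            ∎
      where
      open ≡-Reasoning
      expand : ∀ v a s t → v + a * (s + t) ≡ v + a * s + a * t
      expand = solve-∀
      move : ∀ b j m a q → b * (j + m * a) + a * q ≡ (b * j + a * q) + a * (b * m)
      move = solve-∀

    Q<P : Q < P
    Q<P = ≰⇒> λ P≤Q → <-irrefl v≡N (+-mono-<-≤ (≤-<-trans v≤G G<N) (*-monoʳ-≤ a P≤Q))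

    answer : ∃ λ x → N ≡ a * suc x + v
    answer with m≤n⇒∃[o]m+o≡n Q<P
    ... | x , 1+Q+x≡P = x , +-cancelʳ-≡ (a * Q) _ _ (begin
      N + a * Q                 ≡⟨ v≡N ⟨
      v + a * P                 ≡⟨ cong (λ w → v + a * w) 1+Q+x≡P ⟨
      v + a * (suc Q + x)       ≡⟨ move v a Q x ⟩
      a * suc x + v + a * Q     ∎)
      where
      open ≡-Reasoning
      move : ∀ v a Q x → v + a * (suc Q + x) ≡ a * suc x + v + a * Q
      move = solve-∀

  smaller : ∀ {v w} x → a * x + v + a ≡ w → v < w
  smaller {v} {w} x eq = begin-strict
    v               ≤⟨ m≤n+m v (a * x) ⟩
    a * x + v       <⟨ m<m+n _ (>-nonZero⁻¹ a) ⟩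
    a * x + v + a   ≡⟨ eq ⟩
    w               ∎
    where open ≤-Reasoning

  -- A representation of `b y₁ + c z₁ - a` uses a pair of smaller value whose class is congruent to
  -- `t` modulo `a`. By minimality this class is below `t + a`, hence equal to `t` because `t < a`;
  -- then `t < f` leaves no room for a positive `z`.
  unique-solution : ∀ {t y₁ z₁} → t < a → t < f → y₁ + f * z₁ ≡ t + a →
    (∀ m y z → y + f * z ≡ t + a + m * a → b * y₁ + c * z₁ ≤ b * y + c * z) →
    ∀ x y z → a * x + (b * y + c * z) + a ≡ b * y₁ + c * z₁ → y ≡ t × z ≡ 0
  unique-solution {t} {y₁} {z₁} t<a t<f class₁ minimal x y z eq with
    cancel {t + a} {y + f * z} {e * z} {suc x + e * z₁} (begin
      b * (t + a) + a * (e * z)                      ≡⟨ cong (λ w → b * w + a * (e * z)) class₁ ⟨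
      b * (y₁ + f * z₁) + a * (e * z)                ≡⟨ cong (_+ a * (e * z)) (value-class y₁ z₁) ⟨
      b * y₁ + c * z₁ + a * (e * z₁) + a * (e * z)   ≡⟨ cong (λ w → w + a * (e * z₁) + a * (e * z)) eq ⟨
      a * x + (b * y + c * z) + a + a * (e * z₁) + a * (e * z) ≡⟨ move a x (b * y + c * z) (e * z₁) (e * z) ⟩
      b * y + c * z + a * (e * z) + a * (suc x + e * z₁) ≡⟨ cong (_+ a * (suc x + e * z₁)) (value-class y z) ⟩
      b * (y + f * z) + a * (suc x + e * z₁)         ∎)
    where
    open ≡-Reasoning
    move : ∀ a x v s r → a * x + v + a + a * s + a * r ≡ v + a * r + a * (suc x + s)
    move = solve-∀
  ... | inj₁ (m , class) = contradiction (minimal m y z class) (<⇒≱ (smaller x eq))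
  ... | inj₂ (0 , class) =
    contradiction (minimal 0 y z (trans (sym (+-identityʳ _)) (trans (sym class) (sym (+-identityʳ _)))))
                  (<⇒≱ (smaller x eq))
  -- The surviving case `y + f z = t`: in the clauses above, the class is at least `t + a`, and the
  -- last clause would make `t` at least `a`.
  ... | inj₂ (1 , class) = y≡t , z≡0
    where
    t≡ : t ≡ y + f * z
    t≡ = +-cancelʳ-≡ a _ _ (trans class (cong (y + f * z +_) (+-identityʳ a)))
    fz<f : f * z < f
    fz<f = ≤-<-trans (≤-trans (m≤n+m (f * z) y) (≤-reflexive (sym t≡))) t<f
    z≡0 : z ≡ 0
    z≡0 = n<1⇒n≡0 (*-cancelˡ-< f z 1 (<-≤-trans fz<f (≤-reflexive (sym (*-identityʳ f)))))
    y≡t : y ≡ t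
    y≡t = begin
      y            ≡⟨ +-identityʳ y ⟨
      y + 0        ≡⟨ cong (y +_) (*-zeroʳ f) ⟨
      y + f * 0    ≡⟨ cong (λ w → y + f * w) z≡0 ⟨
      y + f * z    ≡⟨ t≡ ⟨
      t            ∎
      where open ≡-Reasoning
  ... | inj₂ (suc (suc m) , class) = contradiction t<a (≤⇒≯ (begin
      a                           ≤⟨ m≤n+m a (y + f * z + m * a) ⟩
      y + f * z + m * a + a       ≡⟨ +-cancelʳ-≡ a _ _ (trans class (move (y + f * z) m a)) ⟨
      t                           ∎))
    where
    open ≤-Reasoning
    move : ∀ v m a → v + suc (suc m) * a ≡ v + m * a + a + a
    move = solve-∀

  -- If e * f ≤ c, then going once around modulo a costs b, and the additional
  -- multiples of c that it makes room for save at most as much.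
  minimal-value : ∀ {t y₁ z₁} → e * f ≤ c → y₁ < f → y₁ + f * z₁ ≡ t →
    ∀ m y z → y + f * z ≡ t + m * a → b * y₁ + c * z₁ ≤ b * y + c * z
  minimal-value {t} {y₁} {z₁} ef≤c y₁<f refl m y z class =
    +-cancelʳ-≤ (a * (e * z)) _ _ (begin
      b * y₁ + c * z₁ + a * (e * z)                    ≤⟨ +-monoʳ-≤ (b * y₁ + c * z₁) (*-monoʳ-≤ a (saved m class)) ⟩
      b * y₁ + c * z₁ + a * (e * z₁ + b * m)           ≡⟨ move (b * y₁ + c * z₁) a (e * z₁) b m ⟩
      b * y₁ + c * z₁ + a * (e * z₁) + b * (m * a)     ≡⟨ cong (_+ b * (m * a)) (value-class y₁ z₁) ⟩
      b * (y₁ + f * z₁) + b * (m * a)                  ≡⟨ *-distribˡ-+ b (y₁ + f * z₁) (m * a) ⟨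
      b * (y₁ + f * z₁ + m * a)                        ≡⟨ cong (b *_) class ⟨
      b * (y + f * z)                                  ≡⟨ value-class y z ⟨
      b * y + c * z + a * (e * z)                      ∎)
    where
    open ≤-Reasoning
    move : ∀ v a s b m → v + a * (s + b * m) ≡ v + a * s + b * (m * a)
    move = solve-∀
    saved : ∀ m → y + f * z ≡ y₁ + f * z₁ + m * a → e * z ≤ e * z₁ + b * m
    -- Within the same class no pair has a larger `z`: since `y₁ < f`, `z₁` is the quotient of the
    -- class by `f`.
    saved zero class = ≤-trans (*-monoʳ-≤ e z≤z₁) (m≤m+n (e * z₁) (b * 0))
      where
      z≤z₁ : z ≤ z₁
      z≤z₁ = ≤-pred (*-cancelˡ-< f z (suc z₁) (begin-strict
        f * z              ≤⟨ m≤n+m (f * z) y ⟩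
        y + f * z          ≡⟨ class ⟩
        y₁ + f * z₁ + 0    ≡⟨ +-identityʳ _ ⟩
        y₁ + f * z₁        <⟨ +-monoˡ-< (f * z₁) y₁<f ⟩
        f + f * z₁         ≡⟨ *-suc f z₁ ⟨
        f * suc z₁         ∎))
    -- After multiplication by `f`, the class bounds `f z`. Replacing the remainder `y₁` by `f`
    -- costs `e f`, which one of the `suc m` copies of `c` absorbs.
    saved (suc m) class = *-cancelʳ-≤ _ _ f (begin
      e * z * f                                ≡⟨ left e z f ⟩
      e * (f * z)                              ≤⟨ *-monoʳ-≤ e (m≤n+m (f * z) y) ⟩
      e * (y + f * z)                          ≡⟨ cong (e *_) class ⟩
      e * (y₁ + f * z₁ + suc m * a)            ≤⟨ *-monoʳ-≤ e (+-monoˡ-≤ (suc m * a) (+-monoˡ-≤ (f * z₁) (<⇒≤ y₁<f))) ⟩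
      e * (f + f * z₁ + suc m * a)             ≡⟨ expand e f z₁ m a ⟩
      e * f + (e * (f * z₁) + suc m * (e * a)) ≤⟨ +-monoˡ-≤ _ (≤-trans ef≤c (m≤m+n c (m * c))) ⟩
      suc m * c + (e * (f * z₁) + suc m * (e * a)) ≡⟨ collect (suc m) c e f z₁ a ⟩
      e * (f * z₁) + suc m * (c + e * a)       ≡⟨ cong (λ w → e * (f * z₁) + suc m * w) c+ea≡fb ⟩
      e * (f * z₁) + suc m * (f * b)           ≡⟨ right e f z₁ (suc m) b ⟩
      (e * z₁ + b * suc m) * f                 ∎)
      where
      left : ∀ e z f → e * z * f ≡ e * (f * z)
      left = solve-∀
      expand : ∀ e f z m a → e * (f + f * z + suc m * a) ≡ e * f + (e * (f * z) + suc m * (e * a))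
      expand = solve-∀
      collect : ∀ m c e f z a → m * c + (e * (f * z) + m * (e * a)) ≡ e * (f * z) + m * (c + e * a)
      collect = solve-∀
      right : ∀ e f z m b → e * (f * z) + m * (f * b) ≡ (e * z + b * m) * f
      right = solve-∀

  -- Upper bounds: two cheap pairs in every class.

  private
    drop-b : ∀ {G y w z} → y < w → b * w + c * z ≤ G + b → b * y + c * z ≤ G
    drop-b {G} {y} {w} {z} y<w h = +-cancelʳ-≤ b _ _ (begin
      b * y + c * z + b    ≡⟨ move b y (c * z) ⟩
      b * suc y + c * z    ≤⟨ +-monoˡ-≤ (c * z) (*-monoʳ-≤ b y<w) ⟩
      b * w + c * z        ≤⟨ h ⟩
      G + b                ∎)
      where
      open ≤-Reasoning
      move : ∀ b y s → b * y + s + b ≡ b * suc y + s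
      move = solve-∀

    drop-c : ∀ {G y z} → b * y + c * z ≤ G → b * y + c * 0 ≤ G
    drop-c {y = y} h = ≤-trans (+-monoʳ-≤ (b * y) (*-monoʳ-≤ c z≤n)) h

    unwrapped : ∀ j → j + f * 0 ≡ j + 0 * a
    unwrapped j = cong (j +_) (*-zeroʳ f)

    different-class : ∀ {j y z} → y + f * z ≡ j + a → ¬ (j ≡ y × 0 ≡ z)
    different-class {j} class (refl , refl) =
      contradiction (+-cancelˡ-≡ j 0 a (trans (sym (cong (j +_) (*-zeroʳ f))) class))
        (λ 0≡a → <-irrefl 0≡a (>-nonZero⁻¹ a))

    -- The first pair is `(j, 0)`; the second lies one turn further, in class `j + a`, and differs
    -- from the first because `a` is nonzero.
    wrap : ∀ {G j y z} → b * j + c * 0 ≤ G → y + f * z ≡ j + a → b * y + c * z ≤ G → TwoBelow G j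
    wrap {j = j} j≤G class yz≤G = _ , _ , _ , _ , different-class class
      , below 0 (unwrapped j) j≤G
      , below 1 (trans class (cong (j +_) (sym (+-identityʳ a)))) yz≤G

  -- The classes `j + a` lie below `2 a = f + S`, so the second pair is `(j + a, 0)` before `f` and
  -- `(j + a - f, 1)` from `f` on. The two bounds on `G` treat the ends of these two ranges.
  two-below-if-a≤f : ∀ {G S} → a ≤ f → a + a ≡ f + S → b * f ≤ G + b → b * S + c ≤ G + b →
                     ∀ j → j < a → TwoBelow G j
  two-below-if-a≤f {G} {S} a≤f a+a≡f+S f≤G S≤G j j<a with j + a ℕ.<? f
  ... | yes j+a<f = wrap (small (<-≤-trans j<a a≤f)) (trans (cong (j + a +_) (*-zeroʳ f)) (+-identityʳ _)) (small j+a<f)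
    where
    small : ∀ {y} → y < f → b * y + c * 0 ≤ G
    small y<f = drop-b y<f (subst (_≤ G + b) (sym (trans (cong (b * f +_) (*-zeroʳ c)) (+-identityʳ _))) f≤G)
  ... | no j+a≮f with m≤n⇒∃[o]m+o≡n (≮⇒≥ j+a≮f)
  ... | y , f+y≡j+a = wrap
      (drop-b (<-≤-trans j<a a≤f) (subst (_≤ G + b) (sym (trans (cong (b * f +_) (*-zeroʳ c)) (+-identityʳ _))) f≤G))
      (trans (cong (y +_) (*-identityʳ f)) (trans (+-comm y f) f+y≡j+a))
      (drop-b y<S (subst (λ w → b * S + w ≤ G + b) (sym (*-identityʳ c)) S≤G))
    where
    y<S : y < S
    y<S = +-cancelˡ-< f y S (subst₂ _<_ (sym f+y≡j+a) a+a≡f+S (+-monoˡ-< a j<a))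

  -- A class `j ≥ f` has two pairs without a full turn, because one `c` can be traded for `f` copies
  -- of `b`, raising the value by `e a ≤ c`. For `j < f` the second pair comes from
  -- `j + a = f R + (j + S)`, with quotient `R` or `R + 1` according to whether `j + S` reaches `f`.
  two-below-if-f≤a : ∀ {G R S} → e * a ≤ c → S ≤ f → a ≡ f * R + S →
                     b * f + c * R ≤ G + b → b * S + c * suc R ≤ G + b →
                     ∀ j → j < a → TwoBelow G j
  two-below-if-f≤a {G} {R} {S} ea≤c S≤f a≡fR+S f≤G S≤G j j<a with j ℕ.<? f
  ... | no j≮f with m≤n⇒∃[o]m+o≡n (≮⇒≥ j≮f)
  ... | j′ , refl = y , suc q , y + f , q , (λ p → 1+n≢n (proj₂ p))
      , below 0 class (≤-trans first≤second second≤G)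
      , below 0 (trans (carry y f q) class) second≤G
    where
    open ≤-Reasoning
    y q : ℕ
    y = j′ % f
    q = j′ / f
    class : y + f * suc q ≡ f + j′ + 0 * a
    class = trans (regroup y f q) (trans (cong (f +_) (sym (m≡m%n+[m/n]*n j′ f))) (sym (+-identityʳ _)))
      where
      regroup : ∀ y f q → y + f * suc q ≡ f + (y + q * f)
      regroup = solve-∀
    carry : ∀ y f q → y + f + f * q ≡ y + f * suc q
    carry = solve-∀
    second≡ : b * (y + f) + c * q ≡ b * y + c * suc q + e * a
    second≡ = begin-equality
      b * (y + f) + c * q            ≡⟨ expand b y f (c * q) ⟩
      b * y + c * q + f * b          ≡⟨ cong (b * y + c * q +_) c+ea≡fb ⟨
      b * y + c * q + (c + e * a)    ≡⟨ collect b y c q (e * a) ⟩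
      b * y + c * suc q + e * a      ∎
      where
      expand : ∀ b y f s → b * (y + f) + s ≡ b * y + s + f * b
      expand = solve-∀
      collect : ∀ b y c q s → b * y + c * q + (c + s) ≡ b * y + c * suc q + s
      collect = solve-∀
    first≤second : b * y + c * suc q ≤ b * (y + f) + c * q
    first≤second = ≤-trans (m≤m+n _ (e * a)) (≤-reflexive (sym second≡))
    fq′<fR+S : y + f * suc q < f * R + S
    fq′<fR+S = subst₂ _<_ (sym (trans class (+-identityʳ _))) a≡fR+S j<a
    suc-q≤R : suc q ≤ R
    suc-q≤R = ≤-pred (*-cancelˡ-< f (suc q) (suc R) (begin-strict
      f * suc q         ≤⟨ m≤n+m (f * suc q) y ⟩
      y + f * suc q     <⟨ fq′<fR+S ⟩
      f * R + S         ≤⟨ +-monoʳ-≤ (f * R) S≤f ⟩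
      f * R + f         ≡⟨ trans (+-comm (f * R) f) (sym (*-suc f R)) ⟩
      f * suc R         ∎))
    -- The pair `(y, q + 2)` is not one of the two chosen, but its value dominates both since
    -- `e a ≤ c`. As `j < a`, the quotient satisfies `q + 1 ≤ R`; equality confines `y` below `S`,
    -- and otherwise `y < f` and the bound with `R` suffice.
    bound : b * y + c * suc (suc q) ≤ G
    bound with suc (suc q) ℕ.≤? R
    ... | yes q+2≤R = ≤-trans (+-monoʳ-≤ (b * y) (*-monoʳ-≤ c q+2≤R)) (drop-b (m%n<n j′ f) f≤G)
    ... | no q+2≰R = ≤-trans (+-monoʳ-≤ (b * y) (*-monoʳ-≤ c (s≤s suc-q≤R))) (drop-b y<S S≤G)
      where
      y<S : y < S
      y<S = +-cancelˡ-< (f * suc q) y S (begin-strict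
        f * suc q + y    ≡⟨ +-comm _ y ⟩
        y + f * suc q    <⟨ fq′<fR+S ⟩
        f * R + S        ≤⟨ +-monoˡ-≤ S (*-monoʳ-≤ f (≤-pred (≰⇒> q+2≰R))) ⟩
        f * suc q + S    ∎)
    second≤G : b * (y + f) + c * q ≤ G
    second≤G = begin
      b * (y + f) + c * q          ≡⟨ second≡ ⟩
      b * y + c * suc q + e * a    ≤⟨ +-monoʳ-≤ (b * y + c * suc q) ea≤c ⟩
      b * y + c * suc q + c        ≡⟨ collect (b * y) c q ⟩
      b * y + c * suc (suc q)      ≤⟨ bound ⟩
      G                            ∎
      where
      collect : ∀ v c q → v + c * suc q + c ≡ v + c * suc (suc q)
      collect = solve-∀
  two-below-if-f≤a {G} {R} {S} ea≤c S≤f a≡fR+S f≤G S≤G j j<a | yes j<f with j + S ℕ.<? f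
  ... | yes j+S<f = wrap (drop-c {z = R} (drop-b j<f f≤G)) class (drop-b j+S<f f≤G)
    where
    class : j + S + f * R ≡ j + a
    class = trans (+-assoc j S _) (cong (j +_) (trans (+-comm S _) (sym a≡fR+S)))
  ... | no j+S≮f with m≤n⇒∃[o]m+o≡n (≮⇒≥ j+S≮f)
  ... | y , f+y≡j+S = wrap (drop-c {z = R} (drop-b j<f f≤G)) class
      (drop-b (+-cancelˡ-< f y S (subst (_< f + S) (sym f+y≡j+S) (+-monoˡ-< S j<f))) S≤G)
    where
    class : y + f * suc R ≡ j + a
    class = begin
      y + f * suc R        ≡⟨ carry y f R ⟩
      f + y + f * R        ≡⟨ cong (_+ f * R) f+y≡j+S ⟩
      j + S + f * R        ≡⟨ +-assoc j S _ ⟩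
      j + (S + f * R)      ≡⟨ cong (j +_) (+-comm S _) ⟩
      j + (f * R + S)      ≡⟨ cong (j +_) a≡fR+S ⟨
      j + a                ∎
      where
      open ≡-Reasoning
      carry : ∀ y f R → y + f * suc R ≡ f + y + f * R
      carry = solve-∀

  -- From pairs to numbers of solutions.

  private
    dot : ∀ x y z → abc · (x ∷ y ∷ z ∷ []) ≡ a * x + (b * y + c * z)
    dot x y z = cong (λ w → a * x + (b * y + w)) (+-identityʳ (c * z))

    ℤ-cancel : ∀ i j → i ℤ.- j ℤ.+ j ≡ i
    ℤ-cancel = ℤ-Solver.solve-∀

    ℤ-cancel′ : ∀ i j → i ℤ.+ j ℤ.- j ≡ i
    ℤ-cancel′ = ℤ-Solver.solve-∀

    positive : VecAll.All NonZero abc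
    positive = a≢0 VecAll.∷ b≢0 VecAll.∷ c≢0 VecAll.∷ VecAll.[]

    gcd≡1 : Vec.foldr′ gcd 0 abc ≡ 1
    gcd≡1 = a⊥b ( gcd[m,n]∣m a (gcd b (gcd c 0))
                , ∣-trans (gcd[m,n]∣n a (gcd b (gcd c 0))) (gcd[m,n]∣m b (gcd c 0)))

    solution⇒≡ : ∀ {G x y z} → (x ∷ y ∷ z ∷ []) ∈ solutions (ℤ.+ G ℤ.- ℤ.+ a) abc →
                 a * x + (b * y + c * z) + a ≡ G
    solution⇒≡ {G} {x} {y} {z} x∈ = ℤ.+-injective (begin
      ℤ.+ (a * x + (b * y + c * z)) ℤ.+ ℤ.+ a   ≡⟨ cong (λ w → ℤ.+ w ℤ.+ ℤ.+ a) (dot x y z) ⟨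
      ℤ.+ (abc · (x ∷ y ∷ z ∷ [])) ℤ.+ ℤ.+ a    ≡⟨ cong (ℤ._+ ℤ.+ a) is-solution ⟩
      ℤ.+ G ℤ.- ℤ.+ a ℤ.+ ℤ.+ a                 ≡⟨ ℤ-cancel (ℤ.+ G) (ℤ.+ a) ⟩
      ℤ.+ G                                     ∎)
      where
      open ≡-Reasoning
      g : ℤ.ℤ
      g = ℤ.+ G ℤ.- ℤ.+ a
      is-solution : ℤ.+ (abc · (x ∷ y ∷ z ∷ [])) ≡ g
      is-solution = Equivalence.to (∈-solutions g abc (x ∷ y ∷ z ∷ []) positive) x∈

    ≡⇒solution : ∀ {n N x y z} → n ≡ ℤ.+ N ℤ.- ℤ.+ a → N ≡ a * suc x + (b * y + c * z) →
                 (x ∷ y ∷ z ∷ []) ∈ solutions n abc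
    ≡⇒solution {n} {x = x} {y} {z} refl refl = Equivalence.from (∈-solutions n abc (x ∷ y ∷ z ∷ []) positive) (begin
      ℤ.+ (abc · (x ∷ y ∷ z ∷ []))                          ≡⟨ cong ℤ.+_ (dot x y z) ⟩
      ℤ.+ (a * x + (b * y + c * z))                         ≡⟨ ℤ-cancel′ _ (ℤ.+ a) ⟨
      ℤ.+ (a * x + (b * y + c * z) + a) ℤ.- ℤ.+ a           ≡⟨ cong (λ w → ℤ.+ w ℤ.- ℤ.+ a) (move a x (b * y + c * z)) ⟩
      ℤ.+ (a * suc x + (b * y + c * z)) ℤ.- ℤ.+ a           ∎)
      where
      open ≡-Reasoning
      move : ∀ a x v → a * x + v + a ≡ a * suc x + v
      move = solve-∀

  -- If `n > G - a`, then `N = n + a` exceeds `G`, and the two pairs in its class extend to two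
  -- different solutions for `n`.
  few⇒≤ : ∀ {G} → (∀ j → j < a → TwoBelow G j) → ∀ n → d n abc ≤ 1 → n ℤ.≤ ℤ.+ G ℤ.- ℤ.+ a
  few⇒≤ {G} two n d≤1 = ℤ.≮⇒≥ λ g<n → impossible (n ℤ.+ ℤ.+ a) refl
      (subst (ℤ._< n ℤ.+ ℤ.+ a) (ℤ-cancel (ℤ.+ G) (ℤ.+ a)) (ℤ.+-monoˡ-< (ℤ.+ a) g<n))
    where
    impossible : ∀ m → n ℤ.+ ℤ.+ a ≡ m → ¬ (ℤ.+ G ℤ.< m)
    -- `G < m` excludes a negative `m`, so this clause covers every case.
    impossible (ℤ.+ N) eq (ℤ.+<+ G<N) =
      let j , j<a , _ , _ , N≡bj = solvable-< N
          _ , _ , _ , _ , distinct , p , p′ = two j j<a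
          _ , eq₁ = below⇒solution p  G<N N≡bj
          _ , eq₂ = below⇒solution p′ G<N N≡bj
          v≡v′ = length≤1⇒≡ {xs = solutions n abc} d≤1 (≡⇒solution n≡ eq₁) (≡⇒solution n≡ eq₂)
          y≡y′ , rest = ∷-injective (proj₂ (∷-injective v≡v′))
      in distinct (y≡y′ , proj₁ (∷-injective rest))
      where
      n≡ : n ≡ ℤ.+ N ℤ.- ℤ.+ a
      n≡ = trans (sym (ℤ-cancel′ n (ℤ.+ a))) (cong (ℤ._- ℤ.+ a) eq)

  -- By `unique-solution` every solution for `G - a` has the form `(x, t, 0)`, and the equation then
  -- fixes `x`; everything larger is excluded by `few⇒≤`.
  isFrobenius : ∀ {t y₁ z₁} → t < a → t < f → y₁ + f * z₁ ≡ t + a →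
    (∀ m y z → y + f * z ≡ t + a + m * a → b * y₁ + c * z₁ ≤ b * y + c * z) →
    (∀ j → j < a → TwoBelow (b * y₁ + c * z₁) j) →
    IsFrobenius 1 abc (ℤ.+ (b * y₁ + c * z₁) ℤ.- ℤ.+ a)
  isFrobenius {t} {y₁} {z₁} t<a t<f class₁ minimal two = record
    { positive = positive
    ; coprime  = gcd≡1
    ; few      = ≡⇒length≤1 (solutions-unique g abc) same
    ; largest  = few⇒≤ {G} two
    }
    where
    G = b * y₁ + c * z₁
    g = ℤ.+ G ℤ.- ℤ.+ a
    same : ∀ {u v} → u ∈ solutions g abc → v ∈ solutions g abc → u ≡ v
    same {x ∷ y ∷ z ∷ []} {x′ ∷ y′ ∷ z′ ∷ []} u∈ v∈ = combine (unique x y z eq) (unique x′ y′ z′ eq′) eq eq′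
      where
      eq : a * x + (b * y + c * z) + a ≡ G
      eq = solution⇒≡ {G} u∈
      eq′ : a * x′ + (b * y′ + c * z′) + a ≡ G
      eq′ = solution⇒≡ {G} v∈
      unique = unique-solution t<a t<f class₁ minimal
      combine : ∀ {x y z x′ y′ z′} → y ≡ t × z ≡ 0 → y′ ≡ t × z′ ≡ 0 →
                a * x + (b * y + c * z) + a ≡ G → a * x′ + (b * y′ + c * z′) + a ≡ G →
                _≡_ {A = Vec ℕ 3} (x ∷ y ∷ z ∷ []) (x′ ∷ y′ ∷ z′ ∷ [])
      combine {x} {x′ = x′} (refl , refl) (refl , refl) eq eq′ = cong (_∷ t ∷ 0 ∷ [])
        (*-cancelˡ-≡ x x′ a (+-cancelʳ-≡ (b * t + c * 0) _ _ (+-cancelʳ-≡ a _ _ (trans eq (sym eq′)))))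

  -- Explicit values in five regimes.

  -- A single `c` costs at least as much as any pair `(y, 0)` with `y ≤ 2 a`, so two turns by `b`
  -- alone decide everything: the extreme class is `t = a - 1`, with second pair `(2 a - 1, 0)`.
  frobenius-c-large : ∀ {a′} → a ≡ suc a′ → (a + a) * b ≤ c →
                      IsFrobenius 1 abc (ℤ.+ (b * (a + a′) + c * 0) ℤ.- ℤ.+ a)
  frobenius-c-large {a′} a≡ 2ab≤c =
    isFrobenius {t = a′} a′<a (<-≤-trans a′<a a≤f) (trans (f*0 (a + a′)) (+-comm a a′)) minimal two
    where
    open ≤-Reasoning
    f*0 : ∀ y → y + f * 0 ≡ y
    f*0 y = trans (cong (y +_) (*-zeroʳ f)) (+-identityʳ y)
    c*0 : ∀ y → b * y + c * 0 ≡ b * y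
    c*0 y = trans (cong (b * y +_) (*-zeroʳ c)) (+-identityʳ (b * y))
    a′<a : a′ < a
    a′<a = ≤-reflexive (sym a≡)
    a≤f : a ≤ f
    a≤f = *-cancelʳ-≤ a f b (begin
      a * b            ≤⟨ *-monoˡ-≤ b (m≤m+n a a) ⟩
      (a + a) * b      ≤⟨ 2ab≤c ⟩
      c                ≤⟨ m≤m+n c (e * a) ⟩
      c + e * a        ≡⟨ c+ea≡fb ⟩
      f * b            ∎)
    minimal : ∀ m y z → y + f * z ≡ a′ + a + m * a → b * (a + a′) + c * 0 ≤ b * y + c * z
    minimal m y zero class = +-monoˡ-≤ (c * 0) (*-monoʳ-≤ b (begin
      a + a′             ≡⟨ +-comm a a′ ⟩
      a′ + a             ≤⟨ m≤m+n _ (m * a) ⟩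
      a′ + a + m * a     ≡⟨ class ⟨
      y + f * 0          ≡⟨ f*0 y ⟩
      y                  ∎))
    minimal m y (suc z) class = begin
      b * (a + a′) + c * 0    ≡⟨ c*0 (a + a′) ⟩
      b * (a + a′)            ≡⟨ *-comm b (a + a′) ⟩
      (a + a′) * b            ≤⟨ *-monoˡ-≤ b (+-monoʳ-≤ a (<⇒≤ a′<a)) ⟩
      (a + a) * b             ≤⟨ 2ab≤c ⟩
      c                       ≤⟨ m≤m*n c (suc z) ⟩
      c * suc z               ≤⟨ m≤n+m _ (b * y) ⟩
      b * y + c * suc z       ∎
    two : ∀ j → j < a → TwoBelow (b * (a + a′) + c * 0) j
    two j j<a = wrap
      (+-monoˡ-≤ (c * 0) (*-monoʳ-≤ b (≤-trans (<⇒≤ j<a) (m≤m+n a a′))))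
      (f*0 (j + a))
      (+-monoˡ-≤ (c * 0) (*-monoʳ-≤ b (≤-trans (≤-reflexive (+-comm j a)) (+-monoʳ-≤ a j≤a′))))
      where
      j≤a′ : j ≤ a′
      j≤a′ = ≤-pred (≤-trans j<a (≤-reflexive a≡))

  private
    bf≡c+ea : b * f ≡ c + e * a
    bf≡c+ea = trans (*-comm b f) (sym c+ea≡fb)

    suc-b : ∀ y w → b * suc y + w ≡ b * y + w + b
    suc-b = suc-* b
      where
      suc-* : ∀ b y w → b * suc y + w ≡ b * y + w + b
      suc-* = solve-∀

  -- The maximum occurs just before the first `c` fits, at `t + a = f - 1`. The competitor, for
  -- `S > 0`, is `(S - 1, 1)`; since `b f = c + e a`, it is no larger exactly when `b S ≤ e a`.
  frobenius-a<f≤2a-b : ∀ {t S f′} → e * f ≤ c → f ≡ suc f′ → f′ ≡ t + a → a + a ≡ f + S → b * S ≤ e * a →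
                       IsFrobenius 1 abc (ℤ.+ (b * f′ + c * 0) ℤ.- ℤ.+ a)
  frobenius-a<f≤2a-b {t} {S} {f′} ef≤c f≡ f′≡ a+a≡f+S bS≤ea =
    isFrobenius {t} t<a t<f class (minimal-value ef≤c f′<f class)
      (two-below-if-a≤f a≤f a+a≡f+S f≤G S≤G)
    where
    open ≤-Reasoning
    G = b * f′ + c * 0
    f≡1+t+a : f ≡ suc t + a
    f≡1+t+a = trans f≡ (cong suc f′≡)
    a≤f : a ≤ f
    a≤f = ≤-trans (m≤n+m a (suc t)) (≤-reflexive (sym f≡1+t+a))
    t<f : t < f
    t<f = ≤-trans (m≤m+n (suc t) a) (≤-reflexive (sym f≡1+t+a))
    t<a : t < a
    t<a = +-cancelʳ-≤ a (suc t) a (begin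
      suc t + a    ≡⟨ f≡1+t+a ⟨
      f            ≤⟨ m≤m+n f S ⟩
      f + S        ≡⟨ a+a≡f+S ⟨
      a + a        ∎)
    f′<f : f′ < f
    f′<f = ≤-reflexive (sym f≡)
    class : f′ + f * 0 ≡ t + a
    class = trans (cong (f′ +_) (*-zeroʳ f)) (trans (+-identityʳ f′) f′≡)
    bf≡G+b : b * f ≡ G + b
    bf≡G+b = begin-equality
      b * f               ≡⟨ cong (b *_) f≡ ⟩
      b * suc f′          ≡⟨ +-identityʳ _ ⟨
      b * suc f′ + 0      ≡⟨ suc-b f′ 0 ⟩
      b * f′ + 0 + b      ≡⟨ cong (λ w → b * f′ + w + b) (*-zeroʳ c) ⟨
      G + b               ∎
    f≤G : b * f ≤ G + b
    f≤G = ≤-reflexive bf≡G+b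
    S≤G : b * S + c ≤ G + b
    S≤G = begin
      b * S + c      ≤⟨ +-monoˡ-≤ c bS≤ea ⟩
      e * a + c      ≡⟨ +-comm (e * a) c ⟩
      c + e * a      ≡⟨ bf≡c+ea ⟨
      b * f          ≡⟨ bf≡G+b ⟩
      G + b          ∎

  -- With the opposite outcome of that comparison the maximum moves to the largest class
  -- `t = a - 1`, where `2 a - 1 = f + s` gives the pair `(s, 1)`.
  frobenius-a≤f<2a-c : ∀ {s} → e * f ≤ c → a ≤ f → suc s ≤ f → a + a ≡ f + suc s → e * a ≤ b * suc s →
                       IsFrobenius 1 abc (ℤ.+ (b * s + c * 1) ℤ.- ℤ.+ a)
  frobenius-a≤f<2a-c {s} ef≤c a≤f s<f a+a≡f+1+s ea≤bS =
    isFrobenius {ℕ.pred a} pa<a (<-≤-trans pa<a a≤f) class (minimal-value ef≤c s<f class)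
      (two-below-if-a≤f a≤f a+a≡f+1+s f≤G S≤G)
    where
    open ≤-Reasoning
    G = b * s + c * 1
    pa<a : ℕ.pred a < a
    pa<a = ≤-reflexive (suc-pred a)
    class : s + f * 1 ≡ ℕ.pred a + a
    class = suc-injective (begin-equality
      suc (s + f * 1)          ≡⟨ cong (λ w → suc (s + w)) (*-identityʳ f) ⟩
      suc (s + f)              ≡⟨ +-comm (suc s) f ⟩
      f + suc s                ≡⟨ a+a≡f+1+s ⟨
      a + a                    ≡⟨ cong (_+ a) (suc-pred a) ⟨
      suc (ℕ.pred a) + a       ∎)
    S≡G : b * suc s + c ≡ G + b
    S≡G = trans (suc-b s c) (cong (λ w → b * s + w + b) (sym (*-identityʳ c)))
    f≤G : b * f ≤ G + b
    f≤G = begin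
      b * f              ≡⟨ bf≡c+ea ⟩
      c + e * a          ≤⟨ +-monoʳ-≤ c ea≤bS ⟩
      c + b * suc s      ≡⟨ +-comm c _ ⟩
      b * suc s + c      ≡⟨ S≡G ⟩
      G + b              ∎
    S≤G : b * suc s + c ≤ G + b
    S≤G = ≤-reflexive S≡G

  module _ {R s : ℕ} (ef≤c : e * f ≤ c) (ea≤c : e * a ≤ c) (f≤a : f ≤ a) (s<f : s < f) (a≡fR+1+s : a ≡ f * R + suc s) where

    -- The extreme class is `t = f - 1`, the last one that needs a turn: `t + a = s + f (R + 1)`.
    -- Comparison with `(f - 1, R)` reduces to the hypothesis by `b f = c + e a`.
    frobenius-f≤a-c : e * a ≤ b * suc s → IsFrobenius 1 abc (ℤ.+ (b * s + c * suc R) ℤ.- ℤ.+ a)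
    frobenius-f≤a-c ea≤bS =
      isFrobenius {ℕ.pred f} (<-≤-trans pf<f f≤a) pf<f class (minimal-value ef≤c s<f class)
        (two-below-if-f≤a ea≤c s<f a≡fR+1+s f≤G (≤-reflexive (suc-b s _)))
      where
      open ≤-Reasoning
      G = b * s + c * suc R
      pf<f : ℕ.pred f < f
      pf<f = ≤-reflexive (suc-pred f)
      class : s + f * suc R ≡ ℕ.pred f + a
      class = suc-injective (begin-equality
        suc (s + f * suc R)          ≡⟨ move s f R ⟩
        f + (f * R + suc s)          ≡⟨ cong (f +_) a≡fR+1+s ⟨
        f + a                        ≡⟨ cong (_+ a) (suc-pred f) ⟨
        suc (ℕ.pred f) + a           ∎)
        where
        move : ∀ s f R → suc (s + f * suc R) ≡ f + (f * R + suc s)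
        move = solve-∀
      f≤G : b * f + c * R ≤ G + b
      f≤G = begin
        b * f + c * R                ≡⟨ cong (_+ c * R) bf≡c+ea ⟩
        c + e * a + c * R            ≤⟨ +-monoˡ-≤ (c * R) (+-monoʳ-≤ c ea≤bS) ⟩
        c + b * suc s + c * R        ≡⟨ move b c s R ⟩
        G + b                        ∎
        where
        move : ∀ b c s R → c + b * suc s + c * R ≡ b * s + c * suc R + b
        move = solve-∀

    -- The quotient of `j + a` is about to increase at `t = f - 1 - (s + 1)`, where
    -- `t + a = (f - 1) + f R`.
    frobenius-f≤a-b : ∀ {t f′} → f ≡ suc f′ → f′ ≡ t + suc s → b * suc s ≤ e * a →
                      IsFrobenius 1 abc (ℤ.+ (b * f′ + c * R) ℤ.- ℤ.+ a)
    frobenius-f≤a-b {t} {f′} f≡ f′≡ bS≤ea =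
      isFrobenius {t} (<-≤-trans t<f f≤a) t<f class (minimal-value ef≤c (≤-reflexive (sym f≡)) class)
        (two-below-if-f≤a ea≤c s<f a≡fR+1+s (≤-reflexive bf≡G+b) S≤G)
      where
      open ≤-Reasoning
      G = b * f′ + c * R
      t<f : t < f
      t<f = ≤-trans (s≤s (≤-trans (m≤m+n t (suc s)) (≤-reflexive (sym f′≡)))) (≤-reflexive (sym f≡))
      class : f′ + f * R ≡ t + a
      class = begin-equality
        f′ + f * R                ≡⟨ cong (_+ f * R) f′≡ ⟩
        t + suc s + f * R         ≡⟨ +-assoc t (suc s) _ ⟩
        t + (suc s + f * R)       ≡⟨ cong (t +_) (+-comm (suc s) _) ⟩
        t + (f * R + suc s)       ≡⟨ cong (t +_) a≡fR+1+s ⟨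
        t + a                     ∎
      bf≡G+b : b * f + c * R ≡ G + b
      bf≡G+b = trans (cong (λ w → b * w + c * R) f≡) (suc-b f′ (c * R))
      S≤G : b * suc s + c * suc R ≤ G + b
      S≤G = begin
        b * suc s + c * suc R     ≤⟨ +-monoˡ-≤ (c * suc R) bS≤ea ⟩
        e * a + c * suc R         ≡⟨ move (e * a) c R ⟩
        c + e * a + c * R         ≡⟨ cong (_+ c * R) bf≡c+ea ⟨
        b * f + c * R             ≡⟨ bf≡G+b ⟩
        G + b                     ∎
        where
        move : ∀ w c R → w + c * suc R ≡ c + w + c * R
        move = solve-∀

-- Identities for Fibonacci and Lucas numbers.

module Lucas where
  open import Data.Nat using (_+_; _*_; _∸_; _≤_; _<_)

  -- Both sides satisfy the Fibonacci recurrence in `m`. Applied with a numeral `m`, this gives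
  -- linear forms in `F (suc n)` and `F n`, so that the inequalities below become polynomial in two
  -- variables.
  F-+ : ∀ m n → F (m + suc n) ≡ F (suc m) * F (suc n) + F m * F n
  F-+ 0             n = sym (trans (+-identityʳ _) (+-identityʳ (F (suc n))))
  F-+ 1             n = sym (cong₂ _+_ (+-identityʳ (F (suc n))) (+-identityʳ (F n)))
  F-+ (suc (suc m)) n = trans (cong₂ _+_ (F-+ (suc m) n) (F-+ m n))
    (collect (F (2 + m)) (F (1 + m)) (F m) (F (suc n)) (F n))
    where
    collect : ∀ p q r u v → p * u + q * v + (q * u + r * v) ≡ (p + q) * u + (q + r) * v
    collect = solve-∀

  L-+ : ∀ m n → L (m + suc n) ≡ L (suc m) * F (suc n) + L m * F n
  L-+ m zero = begin
    L (m + 1)              ≡⟨ cong L (+-comm m 1) ⟩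
    L (suc m)              ≡⟨ unit (L (suc m)) (L m) ⟩
    L (suc m) * 1 + L m * 0 ∎
    where
    open ≡-Reasoning
    unit : ∀ p q → p ≡ p * 1 + q * 0
    unit = solve-∀
  L-+ m (suc n) = begin
    L (m + suc (suc n))    ≡⟨ cong L (+-suc m (suc n)) ⟩
    L (suc m + suc n)      ≡⟨ L-+ (suc m) n ⟩
    (L (suc m) + L m) * F (suc n) + L (suc m) * F n ≡⟨ collect (L (suc m)) (L m) (F (suc n)) (F n) ⟩
    L (suc m) * (F (suc n) + F n) + L m * F (suc n) ∎
    where
    open ≡-Reasoning
    collect : ∀ p q u v → (p + q) * u + p * v ≡ p * (u + v) + q * u
    collect = solve-∀

  -- Both sides satisfy the Fibonacci recurrence in `k`, so `k = 0` and `k = 1` suffice. This is the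
  -- source of the relation `c + e a = f b`.
  L-F : ∀ k i → L (2 + k + i) + F k * L i ≡ F (2 + k) * L (2 + i)
  L-F 0             i = refl
  L-F 1             i = double (L (suc i)) (L i)
    where
    double : ∀ p q → p + q + p + 1 * q ≡ 2 * (p + q)
    double = solve-∀
  L-F (suc (suc k)) i = begin
    L (3 + k + i) + L (2 + k + i) + (F (1 + k) + F k) * L i          ≡⟨ regroup (L (3 + k + i)) (L (2 + k + i)) (F (1 + k)) (F k) (L i) ⟩
    (L (3 + k + i) + F (1 + k) * L i) + (L (2 + k + i) + F k * L i)  ≡⟨ cong₂ _+_ (L-F (suc k) i) (L-F k i) ⟩
    F (3 + k) * L (2 + i) + F (2 + k) * L (2 + i)                    ≡⟨ *-distribʳ-+ (L (2 + i)) (F (3 + k)) (F (2 + k)) ⟨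
    F (4 + k) * L (2 + i)                                            ∎
    where
    open ≡-Reasoning
    regroup : ∀ p q r s t → p + q + (r + s) * t ≡ (p + r * t) + (q + s * t)
    regroup = solve-∀

  F-≤-suc : ∀ n → F n ≤ F (suc n)
  F-≤-suc zero    = z≤n
  F-≤-suc (suc n) = m≤m+n (F (suc n)) (F n)

  F-mono : ∀ {m n} → m ≤ n → F m ≤ F n
  F-mono {m} m≤n with m≤n⇒∃[o]m+o≡n m≤n
  ... | o , refl = go o
    where
    go : ∀ o → F m ≤ F (m + o)
    go zero    = ≤-reflexive (cong F (sym (+-identityʳ m)))
    go (suc o) = ≤-trans (go o) (≤-trans (F-≤-suc (m + o)) (≤-reflexive (cong F (sym (+-suc m o)))))

  Fₙ₊₁>0 : ∀ n → 0 < F (suc n)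
  Fₙ₊₁>0 n = F-mono {1} {suc n} (s≤s z≤n)

  L-mono : ∀ {m n} → 1 ≤ m → m ≤ n → L m ≤ L n
  L-mono {suc m} _ m≤n with m≤n⇒∃[o]m+o≡n m≤n
  ... | o , refl = go o
    where
    go : ∀ o → L (suc m) ≤ L (suc m + o)
    go zero    = ≤-reflexive (cong L (sym (+-identityʳ (suc m))))
    go (suc o) = ≤-trans (go o) (≤-trans (m≤m+n (L (suc (m + o))) (L (m + o))) (≤-reflexive (cong L (sym (+-suc (suc m) o)))))

  L>0 : ∀ n → 0 < L n
  L>0 zero    = s≤s z≤n
  L>0 (suc n) = L-mono {1} {suc n} (s≤s z≤n) (s≤s z≤n)

  L-nonZero : ∀ n → NonZero (L n)
  L-nonZero n = ℕ.>-nonZero (L>0 n)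

  L-coprime-suc : ∀ n → Coprime (L n) (L (suc n))
  L-coprime-suc zero    (_ , d∣1)       = ∣1⇒≡1 d∣1
  L-coprime-suc (suc n) (d∣L₁ , d∣L₂) = L-coprime-suc n (∣m+n∣m⇒∣n d∣L₂ d∣L₁ , d∣L₁)

  L-coprime : ∀ n → Coprime (L n) (L (2 + n))
  L-coprime n {d} (d∣L₀ , d∣L₂) =
    L-coprime-suc n (d∣L₀ , ∣m+n∣m⇒∣n (subst (d ∣_) (+-comm (L (suc n)) (L n)) d∣L₂) d∣L₀)

  -- The Lucas triple as an instance of the general setting.

  -- Here i = 3 + n, and k stands for the k − 2 of the theorem.
  module Triple (n k : ℕ) {{F≢0 : NonZero (F (2 + k))}} {c : ℕ} (c≡ : c ≡ L (2 + k + (3 + n))) where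
    a b e f u v : ℕ
    a = L (3 + n)
    b = L (3 + n + 2)
    e = F k
    f = F (2 + k)
    u = F (suc n)
    v = F n

    b≡L : b ≡ L (5 + n)
    b≡L = cong L (+-comm (3 + n) 2)

    c+ea≡fb : c + e * a ≡ f * b
    c+ea≡fb = begin
      c + e * a                            ≡⟨ cong (_+ e * a) c≡ ⟩
      L (2 + k + (3 + n)) + e * a          ≡⟨ L-F k (3 + n) ⟩
      f * L (5 + n)                        ≡⟨ cong (f *_) b≡L ⟨
      f * b                                ∎
      where open ≡-Reasoning

    a⊥b : Coprime a b
    a⊥b = subst (Coprime a) (sym b≡L) (L-coprime (3 + n))

    open Frobenius₁ a b c e f {{L-nonZero (3 + n)}} {{L-nonZero (3 + n + 2)}}
      {{subst NonZero (sym c≡) (L-nonZero (2 + k + (3 + n)))}} a⊥b c+ea≡fb public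

    -- The coefficients are `L 3` and `L 2`; those of `b` are `L 5` and `L 4`.
    a≡ : a ≡ 4 * u + 3 * v
    a≡ = L-+ 2 n

    b≡ : b ≡ 11 * u + 7 * v
    b≡ = trans b≡L (L-+ 4 n)

    v≤u : v ≤ u
    v≤u = F-≤-suc n

    -- f ≥ 2 e and b ≥ 2 a, so that c = f b - e a ≥ 3 e a.
    3ea≤c : 3 * (e * a) ≤ c
    3ea≤c = +-cancelʳ-≤ (e * a) _ _ (begin
      3 * (e * a) + e * a    ≡⟨ regroup e a ⟩
      (e + e) * (a + a)      ≤⟨ *-mono-≤ (+-monoˡ-≤ e (F-≤-suc k)) 2a≤b ⟩
      f * b                  ≡⟨ c+ea≡fb ⟨
      c + e * a              ∎)
      where
      open ≤-Reasoning
      regroup : ∀ e a → 3 * (e * a) + e * a ≡ (e + e) * (a + a)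
      regroup = solve-∀
      2a≤b : a + a ≤ b
      2a≤b = ≤-trans (+-monoˡ-≤ a (L-mono (s≤s z≤n) (n≤1+n (3 + n)))) (≤-reflexive (sym b≡L))

    ea≤c : e * a ≤ c
    ea≤c = ≤-trans (m≤m+n (e * a) _) 3ea≤c

    -- Supplies the hypothesis of `minimal-value`; `f ≤ 2 a` holds in all ranges of the theorem
    -- except `k ≥ i + 4`.
    ef≤c : f ≤ a + a → e * f ≤ c
    ef≤c f≤2a = begin
      e * f              ≤⟨ *-monoʳ-≤ e f≤2a ⟩
      e * (a + a)        ≡⟨ *-distribˡ-+ e a a ⟩
      e * a + e * a      ≤⟨ +-monoʳ-≤ (e * a) (m≤m+n (e * a) _) ⟩
      3 * (e * a)        ≤⟨ 3ea≤c ⟩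
      c                  ∎
      where open ≤-Reasoning

  -- The ranges of `k`, from large to small.

  private
    -- Polynomial inequalities are proved by exhibiting the difference with nonnegative coefficients
    -- and leaving an identity to the ring solver.
    slack : ∀ {x z} y → x + y ≡ z → x ≤ z
    slack {x} y x+y≡z = ≤-trans (m≤m+n x y) (≤-reflexive x+y≡z)

  F-suc≡ : ∀ n → ∃ λ m → F (suc n) ≡ suc m
  F-suc≡ n = ℕ.pred (F (suc n)) , sym (suc-pred (F (suc n)) {{ℕ.>-nonZero (Fₙ₊₁>0 n)}})

  -- This is `2 a b ≤ c` at `k = i + 4`; monotonicity of `L` carries it to larger `k`. Adding `e a`
  -- turns the right side into `f b`, and all terms become quadratic in `u` and `v`.
  2LᵢLᵢ₊₂≤L₂ᵢ₊₄ : ∀ n → (L (3 + n) + L (3 + n)) * L (3 + n + 2) ≤ L (4 + (3 + n) + (3 + n))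
  2LᵢLᵢ₊₂≤L₂ᵢ₊₄ n = +-cancelʳ-≤ (e * a) _ _ (begin
    (a + a) * b + e * a            ≡⟨ cong₂ (λ x y → (x + x) * y + e * x) a≡ b≡ ⟩
    (a₀ + a₀) * b₀ + e * a₀         ≡⟨ cong (λ w → (a₀ + a₀) * b₀ + w * a₀) (F-+ 4 n) ⟩
    (a₀ + a₀) * b₀ + (5 * u + 3 * v) * a₀ ≤⟨ slack (35 * (u * u) + 30 * (u * v) + 5 * (v * v)) (expand u v) ⟩
    (13 * u + 8 * v) * b₀           ≡⟨ cong₂ _*_ (sym (F-+ 6 n)) (sym b≡) ⟩
    f * b                          ≡⟨ c+ea≡fb ⟨
    L (4 + (3 + n) + (3 + n)) + e * a ∎)
    where
    open ≤-Reasoning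
    open Triple n (5 + n) {{F-nonZero {7 + n} (s≤s (s≤s (s≤s z≤n)))}} refl
    a₀ b₀ : ℕ
    a₀ = 4 * u + 3 * v
    b₀ = 11 * u + 7 * v
    expand : ∀ u v → (4 * u + 3 * v + (4 * u + 3 * v)) * (11 * u + 7 * v) + (5 * u + 3 * v) * (4 * u + 3 * v)
                       + (35 * (u * u) + 30 * (u * v) + 5 * (v * v))
                     ≡ (13 * u + 8 * v) * (11 * u + 7 * v)
    expand = solve-∀

  frobenius-k≥i+4 : ∀ n k → 7 + n ≤ 2 + k → ∃ λ a′ → L (3 + n) ≡ suc a′ ×
    IsFrobenius 1 (L (3 + n) ∷ L (3 + n + 2) ∷ L (3 + n + (2 + k)) ∷ [])
      (ℤ.+ (L (3 + n + 2) * (L (3 + n) + a′) + L (3 + n + (2 + k)) * 0) ℤ.- ℤ.+ L (3 + n))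
  frobenius-k≥i+4 n k 7+n≤k = _ , a≡1+a′ , frobenius-c-large a≡1+a′ (begin
    (a + a) * b                   ≤⟨ 2LᵢLᵢ₊₂≤L₂ᵢ₊₄ n ⟩
    L (4 + (3 + n) + (3 + n))     ≤⟨ L-mono (s≤s z≤n) (+-monoˡ-≤ (3 + n) 7+n≤k) ⟩
    L (2 + k + (3 + n))           ≡⟨ c≡ ⟨
    L (3 + n + (2 + k))           ∎)
    where
    open ≤-Reasoning
    c≡ : L (3 + n + (2 + k)) ≡ L (2 + k + (3 + n))
    c≡ = cong L (+-comm (3 + n) (2 + k))
    open Triple n k {{F-nonZero {2 + k} (≤-trans (s≤s (s≤s (s≤s z≤n))) 7+n≤k)}} c≡
    a≡1+a′ : a ≡ suc (ℕ.pred a)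
    a≡1+a′ = sym (suc-pred a {{L-nonZero (3 + n)}})

  -- Here `2 a - f = F n`, and `b F n ≤ e a` selects the value at `f - 1`.
  frobenius-k≡i+3 : ∀ n {c} → c ≡ L (6 + n + (3 + n)) → ∃ λ f′ → F (6 + n) ≡ suc f′ ×
    IsFrobenius 1 (L (3 + n) ∷ L (3 + n + 2) ∷ c ∷ []) (ℤ.+ (L (3 + n + 2) * f′ + c * 0) ℤ.- ℤ.+ L (3 + n))
  -- The class is `t = f - 1 - a = 4 u + 2 v - 1`, written with `u = suc u′`.
  frobenius-k≡i+3 n c≡ = _ , f≡ , frobenius-a<f≤2a-b {4 * u′ + 3 + 2 * v} (ef≤c f≤2a) f≡ refl 2a≡f+v bv≤ea
    where
    open Triple n (4 + n) {{F-nonZero {6 + n} (s≤s (s≤s (s≤s z≤n)))}} c≡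
    u′ : ℕ
    u′ = proj₁ (F-suc≡ n)
    f≡ : f ≡ suc (4 * u′ + 3 + 2 * v + a)
    f≡ = begin
      f                                    ≡⟨ F-+ 5 n ⟩
      8 * u + 5 * v                        ≡⟨ split u v ⟩
      4 * u + 2 * v + (4 * u + 3 * v)      ≡⟨ cong₂ (λ w w′ → 4 * w + 2 * v + w′) (proj₂ (F-suc≡ n)) (sym a≡) ⟩
      4 * suc u′ + 2 * v + a               ≡⟨ unfold u′ v a ⟩
      suc (4 * u′ + 3 + 2 * v + a)         ∎
      where
      open ≡-Reasoning
      split : ∀ u v → 8 * u + 5 * v ≡ 4 * u + 2 * v + (4 * u + 3 * v)
      split = solve-∀
      unfold : ∀ u v a → 4 * suc u + 2 * v + a ≡ suc (4 * u + 3 + 2 * v + a)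
      unfold = solve-∀
    2a≡f+v : a + a ≡ f + v
    2a≡f+v = trans (cong₂ _+_ a≡ a≡) (trans (double u v) (cong (_+ v) (sym (F-+ 5 n))))
      where
      double : ∀ u v → 4 * u + 3 * v + (4 * u + 3 * v) ≡ 8 * u + 5 * v + v
      double = solve-∀
    f≤2a : f ≤ a + a
    f≤2a = slack v (sym 2a≡f+v)
    bv≤ea : b * v ≤ e * a
    bv≤ea with m≤n⇒∃[o]m+o≡n v≤u
    -- In `u` and `v` the difference of the two sides is `12 u² + 6 u v - v²`; substituting
    -- `u = v + w` makes all coefficients positive.
    ... | w , v+w≡u = begin
      b * v                                                    ≡⟨ cong (_* v) b≡ ⟩
      (11 * u + 7 * v) * v                                     ≡⟨ cong (λ x → (11 * x + 7 * v) * v) v+w≡u ⟨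
      (11 * (v + w) + 7 * v) * v                               ≤⟨ slack (17 * (v * v) + 30 * (v * w) + 12 * (w * w)) (expand v w) ⟩
      (3 * (v + w) + 2 * v) * (4 * (v + w) + 3 * v)            ≡⟨ cong (λ x → (3 * x + 2 * v) * (4 * x + 3 * v)) v+w≡u ⟩
      (3 * u + 2 * v) * (4 * u + 3 * v)                        ≡⟨ cong₂ _*_ (sym (F-+ 3 n)) (sym a≡) ⟩
      e * a                                                    ∎
      where
      open ≤-Reasoning
      expand : ∀ v w → (11 * (v + w) + 7 * v) * v + (17 * (v * v) + 30 * (v * w) + 12 * (w * w))
                       ≡ (3 * (v + w) + 2 * v) * (4 * (v + w) + 3 * v)
      expand = solve-∀

  -- The term `3 F (i - 1)` is `2 a - f`, since `2 a = 8 u + 6 v` and `f = 5 u + 3 v`. Now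
  -- `e a ≤ b (2 a - f)`, so the maximum is at the last class.
  frobenius-k≡i+2 : ∀ n {c} → c ≡ L (5 + n + (3 + n)) → ∃ λ s → 3 * F (2 + n) ≡ suc s ×
    IsFrobenius 1 (L (3 + n) ∷ L (3 + n + 2) ∷ c ∷ []) (ℤ.+ (L (3 + n + 2) * s + c * 1) ℤ.- ℤ.+ L (3 + n))
  frobenius-k≡i+2 n c≡ = _ , 3F≡ , frobenius-a≤f<2a-c (ef≤c f≤2a) a≤f S≤f 2a≡f+S ea≤bS
    where
    open Triple n (3 + n) {{F-nonZero {5 + n} (s≤s (s≤s (s≤s z≤n)))}} c≡
    u′ s : ℕ
    u′ = proj₁ (F-suc≡ n)
    s = 3 * u′ + 2 + 3 * v
    S≡ : 3 * (u + v) ≡ suc s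
    S≡ = trans (cong (λ w → 3 * (w + v)) (proj₂ (F-suc≡ n))) (unfold u′ v)
      where
      unfold : ∀ u v → 3 * (suc u + v) ≡ suc (3 * u + 2 + 3 * v)
      unfold = solve-∀
    3F≡ : 3 * F (2 + n) ≡ suc s
    3F≡ = S≡
    f≡ : f ≡ 5 * u + 3 * v
    f≡ = F-+ 4 n
    2a≡f+S : a + a ≡ f + suc s
    2a≡f+S = trans (cong₂ _+_ a≡ a≡) (trans (double u v) (cong₂ _+_ (sym f≡) S≡))
      where
      double : ∀ u v → 4 * u + 3 * v + (4 * u + 3 * v) ≡ 5 * u + 3 * v + 3 * (u + v)
      double = solve-∀
    f≤2a : f ≤ a + a
    f≤2a = slack (suc s) (sym 2a≡f+S)
    a≤f : a ≤ f
    a≤f = slack u (trans (cong (_+ u) a≡) (trans (add u v) (sym f≡)))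
      where
      add : ∀ u v → 4 * u + 3 * v + u ≡ 5 * u + 3 * v
      add = solve-∀
    S≤f : suc s ≤ f
    S≤f = slack (2 * u) (trans (cong (_+ 2 * u) (sym S≡)) (trans (add u v) (sym f≡)))
      where
      add : ∀ u v → 3 * (u + v) + 2 * u ≡ 5 * u + 3 * v
      add = solve-∀
    ea≤bS : e * a ≤ b * suc s
    ea≤bS = begin
      e * a                                  ≡⟨ cong₂ _*_ (F-+ 2 n) a≡ ⟩
      (2 * u + 1 * v) * (4 * u + 3 * v)      ≤⟨ slack (25 * (u * u) + 44 * (u * v) + 18 * (v * v)) (expand u v) ⟩
      (11 * u + 7 * v) * (3 * (u + v))       ≡⟨ cong₂ _*_ (sym b≡) S≡ ⟩
      b * suc s                              ∎
      where
      open ≤-Reasoning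
      expand : ∀ u v → (2 * u + 1 * v) * (4 * u + 3 * v) + (25 * (u * u) + 44 * (u * v) + 18 * (v * v))
                       ≡ (11 * u + 7 * v) * (3 * (u + v))
      expand = solve-∀

  module _ (n k : ℕ) (3≤2+k : 3 ≤ 2 + k) where
    private instance
      F≢0 : NonZero (F (2 + k))
      F≢0 = F-nonZero 3≤2+k

    open Triple n k {L (3 + n + (2 + k))} (cong L (+-comm (3 + n) (2 + k)))

    -- Dividing `a - 1` instead of `a` puts `suc s = a - f r` between 1 and `f`: a remainder of zero
    -- becomes a full `f`.
    r s : ℕ
    r = (a ∸ 1) / f
    s = (a ∸ 1) % f

    a≡1+a∸1 : a ≡ suc (a ∸ 1)
    a≡1+a∸1 = sym (m+[n∸m]≡n {1} (L>0 (3 + n)))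

    -- The reason is `F (i + 1) < L i ≤ F (i + 2)`, read off from `3 u + 2 v`, `4 u + 3 v` and
    -- `5 u + 3 v`.
    r≥1⇔k≤i+1 : 1 ≤ r ⇔ 2 + k ≤ 4 + n
    r≥1⇔k≤i+1 = mk⇔
      (λ 1≤r → ≮⇒≥ λ 4+n<2+k → <⇒≢ 1≤r (sym (m<n⇒m/n≡0 (a∸1<f 4+n<2+k))))
      (λ 2+k≤4+n → m≥n⇒m/n>0 (f≤a∸1 2+k≤4+n))
      where
      open ≤-Reasoning
      a∸1<f : 5 + n ≤ 2 + k → a ∸ 1 < f
      a∸1<f h = begin
        suc (a ∸ 1)              ≡⟨ a≡1+a∸1 ⟨
        a                        ≡⟨ a≡ ⟩
        4 * u + 3 * v            ≤⟨ slack u (add u v) ⟩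
        5 * u + 3 * v            ≡⟨ F-+ 4 n ⟨
        F (5 + n)                ≤⟨ F-mono h ⟩
        f                        ∎
        where
        add : ∀ u v → 4 * u + 3 * v + u ≡ 5 * u + 3 * v
        add = solve-∀
      f≤a∸1 : 2 + k ≤ 4 + n → f ≤ a ∸ 1
      f≤a∸1 h = ≤-pred (begin-strict
        f                        ≤⟨ F-mono h ⟩
        F (4 + n)                ≡⟨ F-+ 3 n ⟩
        3 * u + 2 * v            <⟨ m<m+n _ (≤-trans (Fₙ₊₁>0 n) (m≤m+n u v)) ⟩
        3 * u + 2 * v + (u + v)  ≡⟨ add u v ⟩
        4 * u + 3 * v            ≡⟨ a≡ ⟨
        a                        ≡⟨ a≡1+a∸1 ⟩
        suc (a ∸ 1)              ∎)
        where
        add : ∀ u v → 3 * u + 2 * v + (u + v) ≡ 4 * u + 3 * v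
        add = solve-∀

    a≡fr+1+s : a ≡ f * r + suc s
    a≡fr+1+s = begin
      a                  ≡⟨ a≡1+a∸1 ⟩
      suc (a ∸ 1)        ≡⟨ cong suc (m≡m%n+[m/n]*n (a ∸ 1) f) ⟩
      suc (s + r * f)    ≡⟨ commute s r f ⟩
      f * r + suc s      ∎
      where
      open ≡-Reasoning
      commute : ∀ s r f → suc (s + r * f) ≡ f * r + suc s
      commute = solve-∀

    module _ (1≤r : 1 ≤ r) where
      f≤a : f ≤ a
      f≤a = begin
        f                ≤⟨ m≤m*n f r {{ℕ.>-nonZero 1≤r}} ⟩
        f * r            ≤⟨ m≤m+n _ (suc s) ⟩
        f * r + suc s    ≡⟨ a≡fr+1+s ⟨
        a                ∎
        where open ≤-Reasoning

      ef≤c′ : e * f ≤ L (3 + n + (2 + k))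
      ef≤c′ = ef≤c (≤-trans f≤a (m≤m+n a a))

      frobenius-k≤i+1-c : e * a ≤ b * suc s →
        IsFrobenius 1 abc (ℤ.+ (b * s + L (3 + n + (2 + k)) * suc r) ℤ.- ℤ.+ a)
      frobenius-k≤i+1-c = frobenius-f≤a-c ef≤c′ ea≤c f≤a (m%n<n (a ∸ 1) f) a≡fr+1+s

      frobenius-k≤i+1-b : b * suc s < e * a → ∃ λ f′ → f ≡ suc f′ ×
        IsFrobenius 1 abc (ℤ.+ (b * f′ + L (3 + n + (2 + k)) * r) ℤ.- ℤ.+ a)
      frobenius-k≤i+1-b bS<ea with m≤n⇒∃[o]m+o≡n S<f
        where
        open ≤-Reasoning
        -- The strict case hypothesis makes room for `t = f - 1 - (s + 1)`, because
        -- `b (s + 1) < e a ≤ f b`.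
        S<f : suc s < f
        S<f = *-cancelˡ-< b (suc s) f (begin-strict
          b * suc s              <⟨ bS<ea ⟩
          e * a                  ≤⟨ m≤n+m (e * a) _ ⟩
          L (3 + n + (2 + k)) + e * a ≡⟨ c+ea≡fb ⟩
          f * b                  ≡⟨ *-comm f b ⟩
          b * f                  ∎)
      ... | t , S+t≡f = t + suc s , f≡ ,
        frobenius-f≤a-b ef≤c′ ea≤c f≤a (m%n<n (a ∸ 1) f) a≡fr+1+s {t} f≡ refl (<⇒≤ bS<ea)
        where
        f≡ : f ≡ suc (t + suc s)
        f≡ = trans (sym S+t≡f) (cong suc (+-comm (suc s) t))

-- Integer form of the values and of the case distinction.

module _ where
  open import Data.Integer using (+_; _+_; _-_; _*_; _≥_; _<_)

  +[by+cz] : ∀ b c y z → + (b ℕ.* y ℕ.+ c ℕ.* z) ≡ + b * + y + + c * + z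
  +[by+cz] b c y z = cong₂ _+_ (ℤ.pos-* b y) (ℤ.pos-* c z)

  value-a : ∀ {a a′} b c → a ≡ suc a′ →
            + (b ℕ.* (a ℕ.+ a′) ℕ.+ c ℕ.* 0) - + a ≡ (+ 2 * + a - + 1) * + b - + a
  value-a {_} {a′} b c refl = trans (cong (_- + suc a′) (+[by+cz] b c _ 0)) (identity (+ a′) (+ b) (+ c))
    where
    identity : ∀ A B C → B * (+ 1 + A + A) + C * + 0 - (+ 1 + A) ≡ (+ 2 * (+ 1 + A) - + 1) * B - (+ 1 + A)
    identity = ℤ-Solver.solve-∀

  value-b : ∀ {f f′} a b c → f ≡ suc f′ →
            + (b ℕ.* f′ ℕ.+ c ℕ.* 0) - + a ≡ (+ f - + 1) * + b - + a
  value-b {_} {f′} a b c refl = trans (cong (_- + a) (+[by+cz] b c f′ 0)) (identity (+ a) (+ b) (+ c) (+ f′))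
    where
    identity : ∀ A B C F → B * F + C * + 0 - A ≡ (+ 1 + F - + 1) * B - A
    identity = ℤ-Solver.solve-∀

  value-c : ∀ {S s} a b c → S ≡ + suc s →
            + (b ℕ.* s ℕ.+ c ℕ.* 1) - + a ≡ (S - + 1) * + b + + c - + a
  value-c {_} {s} a b c refl = trans (cong (_- + a) (+[by+cz] b c s 1)) (identity (+ a) (+ b) (+ c) (+ s))
    where
    identity : ∀ A B C S → B * S + C * + 1 - A ≡ (+ 1 + S - + 1) * B + C - A
    identity = ℤ-Solver.solve-∀

  value-d₁ : ∀ {S s} a b c r → S ≡ + suc s →
             + (b ℕ.* s ℕ.+ c ℕ.* suc r) - + a ≡ (S - + 1) * + b + (+ r + + 1) * + c - + a
  value-d₁ {_} {s} a b c r refl = trans (cong (_- + a) (+[by+cz] b c s (suc r))) (identity (+ a) (+ b) (+ c) (+ s) (+ r))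
    where
    identity : ∀ A B C S R → B * S + C * (+ 1 + R) - A ≡ (+ 1 + S - + 1) * B + (R + + 1) * C - A
    identity = ℤ-Solver.solve-∀

  value-d₂ : ∀ {f f′} a b c r → f ≡ suc f′ →
             + (b ℕ.* f′ ℕ.+ c ℕ.* r) - + a ≡ (+ f - + 1) * + b + + r * + c - + a
  value-d₂ {_} {f′} a b c r refl = trans (cong (_- + a) (+[by+cz] b c f′ r)) (identity (+ a) (+ b) (+ c) (+ f′) (+ r))
    where
    identity : ∀ A B C F R → B * F + C * R - A ≡ (+ 1 + F - + 1) * B + R * C - A
    identity = ℤ-Solver.solve-∀

  -- Through this, the integer condition on `L i - r F k` becomes the comparison of `b (s + 1)` with
  -- `e a` in natural numbers.
  remainder : ∀ {a f r s} → a ≡ f ℕ.* r ℕ.+ suc s → + a - + r * + f ≡ + suc s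
  remainder {_} {f} {r} {s} refl = trans (cong (λ w → w + + suc s - + r * + f) (ℤ.pos-* f r)) (identity (+ f) (+ r) (+ suc s))
    where
    identity : ∀ F R S → F * R + S - R * F ≡ S
    identity = ℤ-Solver.solve-∀

  compare-≥ : ∀ {S s} a b e → S ≡ + suc s → S * + b ≥ + e * + a → e ℕ.* a ℕ.≤ b ℕ.* suc s
  compare-≥ {_} {s} a b e refl h = subst (e ℕ.* a ℕ.≤_) (*-comm (suc s) b)
    (ℤ.drop‿+≤+ (subst₂ ℤ._≤_ (sym (ℤ.pos-* e a)) (sym (ℤ.pos-* (suc s) b)) h))

  compare-< : ∀ {S s} a b e → S ≡ + suc s → S * + b < + e * + a → b ℕ.* suc s ℕ.< e ℕ.* a
  compare-< {_} {s} a b e refl h = subst (ℕ._< e ℕ.* a) (*-comm (suc s) b)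
    (ℤ.drop‿+<+ (subst₂ _<_ (sym (ℤ.pos-* (suc s) b)) (sym (ℤ.pos-* e a)) h))

open import Data.Integer using (+_; _+_; _-_; _*_; _≥_; _<_)

theorem6 : (i k : ℕ) → 3 ℕ.≤ i → (3≤k : 3 ℕ.≤ k) →
    (i ℕ.+ 4 ℕ.≤ k →
      IsFrobenius 1 (L i ∷ L (i ℕ.+ 2) ∷ L (i ℕ.+ k) ∷ [])
        ((+ 2 * + L i - + 1) * + L (i ℕ.+ 2) - + L i))
    × IsFrobenius 1 (L i ∷ L (i ℕ.+ 2) ∷ L (2 ℕ.* i ℕ.+ 3) ∷ [])
        ((+ F (i ℕ.+ 3) - + 1) * + L (i ℕ.+ 2) - + L i)
    × IsFrobenius 1 (L i ∷ L (i ℕ.+ 2) ∷ L (2 ℕ.* i ℕ.+ 2) ∷ [])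
        ((+ 3 * + F (i ℕ.∸ 1) - + 1) * + L (i ℕ.+ 2) + + L (2 ℕ.* i ℕ.+ 2) - + L i)
    × (let r = _/_ (L i ℕ.∸ 1) (F k) {{F-nonZero 3≤k}} in
        (1 ℕ.≤ r ⇔ k ℕ.≤ i ℕ.+ 1)
        × (1 ℕ.≤ r →
            ((+ L i - + r * + F k) * + L (i ℕ.+ 2) ≥ + F (k ℕ.∸ 2) * + L i →
              IsFrobenius 1 (L i ∷ L (i ℕ.+ 2) ∷ L (i ℕ.+ k) ∷ [])
                ((+ L i - + r * + F k - + 1) * + L (i ℕ.+ 2)
                  + (+ r + + 1) * + L (i ℕ.+ k) - + L i))
            × ((+ L i - + r * + F k) * + L (i ℕ.+ 2) < + F (k ℕ.∸ 2) * + L i →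
              IsFrobenius 1 (L i ∷ L (i ℕ.+ 2) ∷ L (i ℕ.+ k) ∷ [])
                ((+ F k - + 1) * + L (i ℕ.+ 2) + + r * + L (i ℕ.+ k) - + L i))))
theorem6 i@(suc (suc (suc n))) k@(suc (suc k′)) (s≤s (s≤s (s≤s z≤n))) 3≤k@(s≤s (s≤s _)) =
  case-a , case-b , case-c , case-r , λ 1≤r → case-d₁ 1≤r , case-d₂ 1≤r
  where
  a b c r : ℕ
  a = L i
  b = L (i ℕ.+ 2)
  c = L (i ℕ.+ k)
  r = _/_ (L i ℕ.∸ 1) (F k) {{F-nonZero 3≤k}}

  remainder≡ : + a - + r * + F k ≡ + suc (Lucas.s n k′ 3≤k)
  remainder≡ = remainder {r = r} (Lucas.a≡fr+1+s n k′ 3≤k)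

  case-a : i ℕ.+ 4 ℕ.≤ k → IsFrobenius 1 (a ∷ b ∷ c ∷ []) ((+ 2 * + a - + 1) * + b - + a)
  case-a h =
    let _ , a≡ , isF = Lucas.frobenius-k≥i+4 n k′ (subst (ℕ._≤ k) (+-comm i 4) h)
    in subst (IsFrobenius 1 (a ∷ b ∷ c ∷ [])) (value-a b c a≡) isF

  case-b : IsFrobenius 1 (a ∷ b ∷ L (2 ℕ.* i ℕ.+ 3) ∷ []) ((+ F (i ℕ.+ 3) - + 1) * + b - + a)
  case-b =
    let _ , f≡ , isF = Lucas.frobenius-k≡i+3 n {L (2 ℕ.* i ℕ.+ 3)} (cong L (index n))
    in subst (IsFrobenius 1 (a ∷ b ∷ L (2 ℕ.* i ℕ.+ 3) ∷ []))
         (value-b a b (L (2 ℕ.* i ℕ.+ 3)) (trans (cong F (+-comm i 3)) f≡)) isF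
    where
    index : ∀ n → 2 ℕ.* (3 ℕ.+ n) ℕ.+ 3 ≡ 6 ℕ.+ n ℕ.+ (3 ℕ.+ n)
    index = solve-∀

  case-c : IsFrobenius 1 (a ∷ b ∷ L (2 ℕ.* i ℕ.+ 2) ∷ [])
             ((+ 3 * + F (i ℕ.∸ 1) - + 1) * + b + + L (2 ℕ.* i ℕ.+ 2) - + a)
  case-c =
    let _ , S≡ , isF = Lucas.frobenius-k≡i+2 n {L (2 ℕ.* i ℕ.+ 2)} (cong L (index n))
    in subst (IsFrobenius 1 (a ∷ b ∷ L (2 ℕ.* i ℕ.+ 2) ∷ []))
         (value-c a b (L (2 ℕ.* i ℕ.+ 2)) (trans (sym (ℤ.pos-* 3 (F (i ℕ.∸ 1)))) (cong +_ S≡))) isF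
    where
    index : ∀ n → 2 ℕ.* (3 ℕ.+ n) ℕ.+ 2 ≡ 5 ℕ.+ n ℕ.+ (3 ℕ.+ n)
    index = solve-∀

  case-r : 1 ℕ.≤ r ⇔ k ℕ.≤ i ℕ.+ 1
  case-r = subst (λ w → 1 ℕ.≤ r ⇔ k ℕ.≤ w) (+-comm 1 i) (Lucas.r≥1⇔k≤i+1 n k′ 3≤k)

  case-d₁ : 1 ℕ.≤ r → (+ a - + r * + F k) * + b ≥ + F k′ * + a →
            IsFrobenius 1 (a ∷ b ∷ c ∷ []) ((+ a - + r * + F k - + 1) * + b + (+ r + + 1) * + c - + a)
  case-d₁ 1≤r h = subst (IsFrobenius 1 (a ∷ b ∷ c ∷ [])) (value-d₁ a b c r remainder≡)
    (Lucas.frobenius-k≤i+1-c n k′ 3≤k 1≤r (compare-≥ a b (F k′) remainder≡ h))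

  case-d₂ : 1 ℕ.≤ r → (+ a - + r * + F k) * + b < + F k′ * + a →
            IsFrobenius 1 (a ∷ b ∷ c ∷ []) ((+ F k - + 1) * + b + + r * + c - + a)
  case-d₂ 1≤r h =
    let _ , f≡ , isF = Lucas.frobenius-k≤i+1-b n k′ 3≤k 1≤r (compare-< a b (F k′) remainder≡ h)
    in subst (IsFrobenius 1 (a ∷ b ∷ c ∷ [])) (value-d₂ a b c r f≡) isF
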